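{- Let $\mathsf{L}$ and $\mathsf{H}$ be simplicial complexes, and let $G_0$ be a facet of $\mathsf{H}$ such that $2\leq |G_0|\leq |G|$ for any facet $G$ of $\mathsf{H}$. Then one of the following holds. (1) $\mathrm{C}(\mathsf{L};\mathsf{H})\leq \eta(\mathsf{L})$, if $|F|\geq |G_0|$ for any facet $F$ of $\mathsf{L}$. (2) $\mathrm{C}(\mathsf{L};\mathsf{H})=\infty$, otherwise.
   Context: A simplicial complex is an abstract simplicial complex: a set $\mathsf{K}$ of subsets (simplices) of a vertex set $V(\mathsf{K})=\bigcup\mathsf{K}$ such that $F\in\mathsf{K}$ and $G\subseteq F$ imply $G\in\mathsf{K}$. A facet is a simplex that is maximal with respect to inclusion; a facet is non-unitary if it has at least two vertices. The number of facets of $\mathsf{L}$ is denoted $\eta(\mathsf{L})$. A subcomplex of $\mathsf{K}$ is a simplicial complex contained in $\mathsf{K}$. The union of simplicial complexes is the union of their vertex sets and of their sets of simplices. A simplicial map $f:\mathsf{L}\to\mathsf{K}$ is a map $f:V(\mathsf{L})\to V(\mathsf{K})$ such that $f(F)\in\mathsf{K}$ whenever $F\in\mathsf{L}$. A facet simplicial map is a simplicial map $f:\mathsf{L}\to\mathsf{K}$ such that $f(F)$ is a non-unitary facet of $\mathsf{K}$ whenever $F$ is a non-unitary facet of $\mathsf{L}$. The facet-complexity $\mathrm{C}(\mathsf{L};\mathsf{K})$ is the least positive integer $k$ such that there exist subcomplexes $\mathsf{L}_1,\ldots,\mathsf{L}_k$ of $\mathsf{L}$ with $\mathsf{L}=\mathsf{L}_1\cup\cdots\cup\mathsf{L}_k$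 and, for each $i$, a facet simplicial map $f_i:\mathsf{L}_i\to\mathsf{K}$; it is $\infty$ if no such $k$ exists.
   Formalization: The size condition separating (1) and (2) is imposed only on non-unitary facets of L (for L a single vertex, C(L;H)=1, not ∞), and L is assumed to have at least one facet (otherwise η(L)=0 while C(L;H)≥1); vertex sets have decidable equality. -}

module Defs where

open import Data.Fin using (Fin)
open import Data.List using (List; length; deduplicate)
open import Data.List.Membership.Propositional using (_∈_; mapWith∈)
open import Data.List.Relation.Binary.BagAndSetEquality using ([_]-Equality; set)
open import Data.List.Relation.Binary.Subset.Propositional using (_⊆_)
open import Data.Nat using (ℕ; _≤_; _≤?_)
open import Data.Nat.Induction using (<-rec)
open import Data.Nat.Properties using (≤-antisym; ≰⇒>)
open import Data.Product using (∃; ∃-syntax; ∃₂; _×_; _,_; proj₁)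
open import Function.Bundles using (Bijection)
open import Level using (0ℓ)
open import Relation.Binary.Bundles using (Setoid)
open import Relation.Binary.Construct.Add.Supremum.NonStrict _≤_ using (_≤⁺_) public
open import Relation.Binary.Definitions using (DecidableEquality)
open import Relation.Binary.PropositionalEquality using (_≡_; _≢_; refl; cong)
import Relation.Binary.PropositionalEquality as ≡
import Relation.Binary.Construct.On as On
open import Relation.Nullary using (¬_; yes; no; contradiction)
open import Relation.Nullary.Construct.Add.Supremum using (_⁺; ⊤⁺; [_])
open import Relation.Unary using (Pred; _≐_; ⋃)

private
  variable
    V W : Set

-- A finite set of vertices is a list, considered up to having the same
-- members: order and repetitions are irrelevant.  Its cardinality is the
-- number of distinct entries.

size : DecidableEquality V → List V → ℕ
size _≟_ F = length (deduplicate _≟_ F)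

-- V is only an ambient set from which vertices are taken: the vertex set is
-- the union of the simplices, see _∈V_.  Simplices are finite, but a complex
-- may have infinitely many of them, and it may also have none at all.
-- Since list inclusion ignores order and repetitions, closure under subsets
-- makes the family invariant under equality of finite sets.

record SimplicialComplex (V : Set) : Set₁ where
  field
    Simplex : Pred (List V) 0ℓ
    closed  : ∀ {F G} → Simplex F → G ⊆ F → Simplex G

open SimplicialComplex public

_∈V_ : V → SimplicialComplex V → Set
v ∈V K = ∃[ F ] (Simplex K F × v ∈ F)

Facet : SimplicialComplex V → Pred (List V) 0ℓ
Facet K F = Simplex K F × (∀ {G} → Simplex K G → F ⊆ G → G ⊆ F)

NonUnitaryFacet : SimplicialComplex V → Pred (List V) 0ℓ
NonUnitaryFacet K F = Facet K F × ∃₂ λ x y → x ∈ F × y ∈ F × x ≢ y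

-- Facets up to equality of finite sets.

facetSetoid : SimplicialComplex V → Setoid 0ℓ 0ℓ
facetSetoid {V} K = On.setoid {B = ∃ (Facet K)} ([ set ]-Equality V) proj₁

-- FacetNumber K e says η(K) = e, where ℕ ⁺ is ℕ ∪ {∞} and ⊤⁺ is ∞.

FacetNumber : SimplicialComplex V → ℕ ⁺ → Set
FacetNumber K [ m ] = Bijection (≡.setoid (Fin m)) (facetSetoid K)
FacetNumber K ⊤⁺    = ∀ m → ¬ Bijection (≡.setoid (Fin m)) (facetSetoid K)

-- The map is defined on the vertex set of L only; irrelevance of the
-- membership proof makes it a function of the vertex alone.

record FacetSimplicialMap (L : SimplicialComplex V) (K : SimplicialComplex W) : Set where
  field
    fun : (v : V) → .(v ∈V L) → W

  image : ∀ {F} → Simplex L F → List W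
  image {F} F∈L = mapWith∈ F (λ {v} v∈F → fun v (F , F∈L , v∈F))

  field
    simplicial : ∀ {F} (F∈L : Simplex L F) → Simplex K (image F∈L)
    facet      : ∀ {F} (F∈L : Simplex L F) →
                 NonUnitaryFacet L F → NonUnitaryFacet K (image F∈L)

-- The equality of families of simplices in union also makes every piece a
-- subcomplex of L, and V(L) the union of the vertex sets of the pieces.

record FacetCover (L : SimplicialComplex V) (K : SimplicialComplex W) (k : ℕ) : Set₁ where
  field
    piece : Fin k → SimplicialComplex V
    union : Simplex L ≐ ⋃ (Fin k) (λ i → Simplex (piece i))
    map   : ∀ i → FacetSimplicialMap (piece i) K

-- FacetComplexity L K c says C(L;K) = c.  It is a relation because the
-- least k cannot be computed for arbitrary complexes; the two lemmas below
-- show that it determines c, and that (classically) c always exists.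

FacetComplexity : SimplicialComplex V → SimplicialComplex W → ℕ ⁺ → Set₁
FacetComplexity L K [ k ] =
  1 ≤ k × FacetCover L K k × (∀ {j} → 1 ≤ j → FacetCover L K j → k ≤ j)
FacetComplexity L K ⊤⁺    = ∀ {j} → 1 ≤ j → ¬ FacetCover L K j

module _ {L : SimplicialComplex V} {K : SimplicialComplex W} where

  facetComplexity-unique : ∀ {c d} → FacetComplexity L K c → FacetComplexity L K d → c ≡ d
  facetComplexity-unique {[ k ]} {[ j ]} (1≤k , ck , mink) (1≤j , cj , minj) =
    cong [_] (≤-antisym (mink 1≤j cj) (minj 1≤k ck))
  facetComplexity-unique {[ k ]} {⊤⁺} (1≤k , ck , _) none = contradiction ck (none 1≤k)
  facetComplexity-unique {⊤⁺} {[ j ]} none (1≤j , cj , _) = contradiction cj (none 1≤j)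
  facetComplexity-unique {⊤⁺} {⊤⁺} _ _ = refl

  facetComplexity-exists : ¬ ¬ ∃ (FacetComplexity L K)
  facetComplexity-exists ¬∃ = ¬∃ (⊤⁺ , λ {j} → none j)
    where
    none : ∀ j → 1 ≤ j → ¬ FacetCover L K j
    none = <-rec _ λ k smaller 1≤k ck →
      ¬∃ ([ k ] , 1≤k , ck , λ {j} 1≤j cj → least smaller 1≤j cj)
      where
      least : ∀ {k j} → (∀ {i} → i Data.Nat.< k → 1 ≤ i → ¬ FacetCover L K i) →
              1 ≤ j → FacetCover L K j → k ≤ j
      least {k} {j} smaller 1≤j cj with k ≤? j
      ... | yes k≤j = k≤j
      ... | no  k≰j = contradiction cj (smaller (≰⇒> k≰j) 1≤j)

{-# OPTIONS --safe #-}

-- If every non-unitary facet F of L has at least |G₀| vertices, each F maps onto G₀, and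
-- since all vertices go to G₀ such a map is simplicial on every subcomplex of
-- L; so one piece per facet suffices.  As L may be infinite, some simplices lie
-- in no facet: each piece also takes those (and their faces), which adds no
-- facet to it.  Conversely a facet of L is a facet of a piece containing it,
-- and its image, a facet of H, has no more vertices than it has.

module Submission where

open import Defs
open import Data.Empty using (⊥-elim)
open import Data.Fin using (Fin; zero; suc)
open import Data.Fin.Properties using (any?; injective⇒≤)
open import Data.List using (List; []; _∷_; length; lookup; deduplicate)
open import Data.List.Membership.Propositional using (_∈_; mapWith∈)
open import Data.List.Membership.Propositional.Properties
  using (∈-lookup; ∈-deduplicate⁺; ∈-deduplicate⁻)
open import Data.List.Membership.Setoid.Properties using (index-injective; length-mapWith∈)
open import Data.List.Relation.Binary.Subset.DecPropositional using (_⊆?_)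
open import Data.List.Relation.Binary.Subset.Propositional using (_⊆_)
open import Data.List.Relation.Binary.Subset.Propositional.Properties using (⊆-refl)
import Data.List.Relation.Unary.All as All
open import Data.List.Relation.Unary.AllPairs using (_∷_)
open import Data.List.Relation.Unary.Any using (here; there; index)
open import Data.List.Relation.Unary.Any.Properties using (mapWith∈⁺; mapWith∈⁻)
open import Data.List.Relation.Unary.Unique.DecPropositional.Properties using (deduplicate-!)
open import Data.List.Relation.Unary.Unique.Propositional using (Unique)
open import Data.Nat using (ℕ; _≤_; s≤s; z≤n)
open import Data.Nat.Properties using (module ≤-Reasoning)
open import Data.Product using (∃; ∃₂; ∃-syntax; _×_; _,_; proj₁; proj₂)
open import Data.Sum using (_⊎_; inj₁; inj₂)
open import Function using (_∘_)
open import Function.Bundles using (Bijection; Equivalence)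
open import Relation.Binary.Construct.Add.Supremum.NonStrict _≤_ using ([_]; _≤⊤⁺)
open import Relation.Binary.Definitions using (DecidableEquality)
open import Relation.Binary.PropositionalEquality using (_≡_; _≢_; refl; sym; cong; setoid)
open import Relation.Nullary using (¬_; yes; no; contradiction)
open import Relation.Nullary.Construct.Add.Supremum using (_⁺; ⊤⁺; [_])

private
  variable
    V W : Set

lookup-injective : ∀ {xs : List V} → Unique xs → ∀ {i j} → lookup xs i ≡ lookup xs j → i ≡ j
lookup-injective (_ ∷ _)    {zero}  {zero}  _  = refl
lookup-injective (x≢ ∷ _)   {zero}  {suc j} eq = contradiction eq (All.lookup x≢ (∈-lookup j))
lookup-injective (x≢ ∷ _)   {suc i} {zero}  eq = contradiction (sym eq) (All.lookup x≢ (∈-lookup i))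
lookup-injective (_ ∷ xs!)  {suc i} {suc j} eq = cong suc (lookup-injective xs! eq)

-- Pigeonhole: each position of `xs` is sent to a position of the same entry in `ys`, which is
-- injective because `xs` has no repetitions.
unique-⊆⇒length≤ : ∀ {xs ys : List V} → Unique xs → xs ⊆ ys → length xs ≤ length ys
unique-⊆⇒length≤ {xs = xs} {ys} xs! xs⊆ys = injective⇒≤ {f = λ i → index (position i)} λ {i} {j} eq →
  lookup-injective xs! (index-injective (setoid _) (position i) (position j) eq)
  where
  position : ∀ i → lookup xs i ∈ ys
  position i = xs⊆ys (∈-lookup i)

module _ (_≟_ : DecidableEquality V) where

  -- `ys` is measured by `length` so that it may contain repetitions, as the image list of a
  -- non-injective map does.
  size-⊆ : ∀ xs {ys} → xs ⊆ ys → size _≟_ xs ≤ length ys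
  size-⊆ xs xs⊆ys =
    unique-⊆⇒length≤ (deduplicate-! _≟_ xs) (xs⊆ys ∘ ∈-deduplicate⁻ _≟_ xs)

  distinct-members : ∀ xs → 2 ≤ size _≟_ xs → ∃₂ λ x y → x ∈ xs × y ∈ xs × x ≢ y
  distinct-members xs 2≤ = go (deduplicate-! _≟_ xs) (∈-deduplicate⁻ _≟_ xs) 2≤
    where
    go : ∀ {zs} → Unique zs → zs ⊆ xs → 2 ≤ length zs → ∃₂ λ x y → x ∈ xs × y ∈ xs × x ≢ y
    go {_ ∷ []}    _                 _     (s≤s ())
    go {_ ∷ _ ∷ _} ((x≢y All.∷ _) ∷ _) zs⊆xs _ =
      _ , _ , zs⊆xs (here refl) , zs⊆xs (there (here refl)) , x≢y

  -- The default `d` serves vertices outside `xs`, and entries of `xs` left over when `ys` is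
  -- shorter, so that one function on all of `V` is obtained.
  assign : List V → List W → W → V → W
  assign (x ∷ xs) (y ∷ ys) d v with v ≟ x
  ... | yes _ = y
  ... | no  _ = assign xs ys d v
  assign _ _ d v = d

  assign-∈ : ∀ xs {ys zs : List W} {d} → ys ⊆ zs → d ∈ zs → ∀ v → assign xs ys d v ∈ zs
  assign-∈ []       _              d∈zs v = d∈zs
  assign-∈ (x ∷ xs) {[]}   _     d∈zs v = d∈zs
  assign-∈ (x ∷ xs) {_ ∷ _} ys⊆zs d∈zs v with v ≟ x
  ... | yes _ = ys⊆zs (here refl)
  ... | no  _ = assign-∈ xs (ys⊆zs ∘ there) d∈zs v

  -- Without repetitions in `xs`, the first match of an entry is its own position, and the length
  -- bound gives each position of `ys` a partner in `xs`.
  assign-onto : ∀ {xs} {ys : List W} {d} → Unique xs → length ys ≤ length xs →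
                ∀ {w} → w ∈ ys → ∃[ v ] (v ∈ xs × w ≡ assign xs ys d v)
  assign-onto {xs = x ∷ xs} {y ∷ ys} {d} (x≢ ∷ xs!) (s≤s ys≤xs) (here refl) = x , here refl , first
    where
    first : y ≡ assign (x ∷ xs) (y ∷ ys) d x
    first with x ≟ x
    ... | yes _   = refl
    ... | no  x≢x = contradiction refl x≢x
  assign-onto {xs = x ∷ xs} {y ∷ ys} {d} (x≢ ∷ xs!) (s≤s ys≤xs) {w} (there w∈ys)
    with assign-onto {d = d} xs! ys≤xs w∈ys
  ... | v , v∈xs , w≡ = v , there v∈xs , later
    where
    later : w ≡ assign (x ∷ xs) (y ∷ ys) d v
    later with v ≟ x
    ... | yes v≡x = contradiction (sym v≡x) (All.lookup x≢ v∈xs)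
    ... | no  _   = w≡

facet-restrict : (L L′ : SimplicialComplex V) → (∀ {S} → Simplex L′ S → Simplex L S) →
                 ∀ {F} → Simplex L′ F → NonUnitaryFacet L F → NonUnitaryFacet L′ F
facet-restrict _ _ L′⊆L F∈L′ ((_ , max) , two) = (F∈L′ , λ G∈L′ → max (L′⊆L G∈L′)) , two

-- With this, an image list needs only the same members as `G₀`, in any order and with any
-- repetitions.
nonUnitaryFacet-resp : (K : SimplicialComplex V) → ∀ {F G} → F ⊆ G → G ⊆ F →
                       NonUnitaryFacet K F → NonUnitaryFacet K G
nonUnitaryFacet-resp K F⊆G G⊆F ((F∈K , max) , x , y , x∈F , y∈F , x≢y) =
  (closed K F∈K G⊆F , λ H∈K G⊆H v∈H → F⊆G (max H∈K (G⊆H ∘ F⊆G) v∈H)) ,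
  x , y , F⊆G x∈F , F⊆G y∈F , x≢y

module _ (_≟V_ : DecidableEquality V) (_≟W_ : DecidableEquality W) where

  size-image : {L : SimplicialComplex V} {K : SimplicialComplex W} (f : FacetSimplicialMap L K) →
               ∀ {F} (F∈L : Simplex L F) →
               size _≟W_ (FacetSimplicialMap.image f F∈L) ≤ size _≟V_ F
  size-image {L} f {F} F∈L = begin
    size _≟W_ (image F∈L)  ≤⟨ size-⊆ _≟W_ (image F∈L) image⊆ ⟩
    length (image F′∈L)    ≡⟨ length-mapWith∈ (setoid V) (deduplicate _≟V_ F) ⟩
    size _≟V_ F            ∎
    where
    open FacetSimplicialMap f
    open ≤-Reasoning
    -- Deduplicating first makes the length of the image exactly the size of `F`. No value is lost,
    -- since `fun` depends on the vertex alone and not on the membership proof.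
    F′∈L : Simplex L (deduplicate _≟V_ F)
    F′∈L = closed L F∈L (∈-deduplicate⁻ _≟V_ F)
    image⊆ : image F∈L ⊆ image F′∈L
    image⊆ w∈ with mapWith∈⁻ F _ w∈
    ... | v , v∈F , refl = mapWith∈⁺ _ (v , ∈-deduplicate⁺ _≟V_ v∈F , refl)

  -- The number `k` of pieces is arbitrary, so failure of the bound excludes every finite
  -- complexity. Facet maps constrain non-unitary facets only, hence the restriction on `F`.
  facet-size-bound : ∀ {L : SimplicialComplex V} {H : SimplicialComplex W} {n k} →
    (∀ G → Facet H G → n ≤ size _≟W_ G) → FacetCover L H k →
    ∀ F → NonUnitaryFacet L F → n ≤ size _≟V_ F
  facet-size-bound {L} {n = n} minimal cover F nuF@((F∈L , _) , _) with proj₁ union F∈L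
    where open FacetCover cover
  ... | i , F∈Lᵢ = begin
    n                         ≤⟨ minimal _ (proj₁ (facet F∈Lᵢ F-facetᵢ)) ⟩
    size _≟W_ (image F∈Lᵢ)    ≤⟨ size-image (map i) {F} F∈Lᵢ ⟩
    size _≟V_ F               ∎
    where
    open FacetCover cover
    open FacetSimplicialMap (map i)
    open ≤-Reasoning
    Lᵢ⊆L : ∀ {S} → Simplex (piece i) S → Simplex L S
    Lᵢ⊆L S∈Lᵢ = proj₂ union (i , S∈Lᵢ)
    F-facetᵢ : NonUnitaryFacet (piece i) F
    F-facetᵢ = facet-restrict L (piece i) Lᵢ⊆L F∈Lᵢ nuF

  module _ (L : SimplicialComplex V) (H : SimplicialComplex W)
    {G₀ : List W} (G₀-facet : Facet H G₀) (2≤G₀ : 2 ≤ size _≟W_ G₀)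
    (large : ∀ F → NonUnitaryFacet L F → size _≟W_ G₀ ≤ size _≟V_ F)
    {m : ℕ} (facets : Fin m → List V) (isFacet : ∀ i → Facet L (facets i))
    (complete : ∀ {F} → Facet L F → ∃[ i ] (F ⊆ facets i)) where

    -- By `complete`, an uncovered simplex lies in no facet of `L`. The property passes to
    -- supersets, so every simplex above an uncovered one belongs to all pieces.
    Uncovered : List V → Set
    Uncovered T = ∀ j → ¬ T ⊆ facets j

    -- A face of an uncovered simplex may itself lie in some facet; the witness `T` keeps the second
    -- alternative closed under subsets.
    facetPiece : Fin m → SimplicialComplex V
    facetPiece i .Simplex S =
      Simplex L S × (S ⊆ facets i ⊎ ∃[ T ] (Simplex L T × Uncovered T × S ⊆ T))
    facetPiece i .closed (F∈L , inj₁ F⊆Fᵢ) G⊆F = closed L F∈L G⊆F , inj₁ (F⊆Fᵢ ∘ G⊆F)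
    facetPiece i .closed (F∈L , inj₂ (T , T∈L , T-unc , F⊆T)) G⊆F =
      closed L F∈L G⊆F , inj₂ (T , T∈L , T-unc , F⊆T ∘ G⊆F)

    -- A simplex maximal among the uncovered ones would be an uncovered facet of L.
    facetPiece-facet : ∀ i {F} → Facet (facetPiece i) F → F ⊆ facets i × facets i ⊆ F
    facetPiece-facet i ((_ , inj₁ F⊆Fᵢ) , max) =
      F⊆Fᵢ , max (proj₁ (isFacet i) , inj₁ ⊆-refl) F⊆Fᵢ
    facetPiece-facet i {F} ((F∈L , inj₂ (T , T∈L , T-unc , F⊆T)) , max) =
      ⊥-elim (T-unc j (F⊆Fⱼ ∘ T⊆F))
      where
      T⊆F : T ⊆ F
      T⊆F = max (T∈L , inj₂ (T , T∈L , T-unc , ⊆-refl)) F⊆T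
      F-facet : Facet L F
      F-facet = F∈L , λ {G} G∈L F⊆G →
        max (G∈L , inj₂ (G , G∈L , (λ j G⊆Fⱼ → T-unc j (λ v∈T → G⊆Fⱼ (F⊆G (T⊆F v∈T)))) , ⊆-refl)) F⊆G
      j : Fin m
      j = proj₁ (complete F-facet)
      F⊆Fⱼ : F ⊆ facets j
      F⊆Fⱼ = proj₂ (complete F-facet)

    facetPiece-map : ∀ i → FacetSimplicialMap (facetPiece i) H
    facetPiece-map i = record
      { fun        = λ v _ → φ v
      ; simplicial = λ F∈Lᵢ → closed H (proj₁ G₀-facet) (image⊆G₀ _)
      ; facet      = λ {F} F∈Lᵢ nuF → nonUnitaryFacet-resp H (G₀⊆image nuF) (image⊆G₀ F)
                                        (G₀-facet , distinct-members _≟W_ G₀ 2≤G₀)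
      }
      where
      -- A default value taken inside `G₀`, so that `φ` never leaves `G₀`; it exists because `G₀`
      -- has at least two vertices.
      w₀ : W
      w₀ = proj₁ (distinct-members _≟W_ G₀ 2≤G₀)
      w₀∈G₀ : w₀ ∈ G₀
      w₀∈G₀ = proj₁ (proj₂ (proj₂ (distinct-members _≟W_ G₀ 2≤G₀)))
      φ : V → W
      φ = assign _≟V_ (deduplicate _≟V_ (facets i)) (deduplicate _≟W_ G₀) w₀
      φ∈G₀ : ∀ v → φ v ∈ G₀
      φ∈G₀ = assign-∈ _≟V_ (deduplicate _≟V_ (facets i)) (∈-deduplicate⁻ _≟W_ G₀) w₀∈G₀
      image⊆G₀ : ∀ F → mapWith∈ F (λ {v} _ → φ v) ⊆ G₀
      image⊆G₀ F w∈ with mapWith∈⁻ F (λ {v} _ → φ v) w∈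
      ... | v , _ , refl = φ∈G₀ v
      G₀⊆image : ∀ {F} → NonUnitaryFacet (facetPiece i) F → G₀ ⊆ mapWith∈ F (λ {v} _ → φ v)
      G₀⊆image {F} (F-facet , x , y , x∈F , y∈F , x≢y) w∈G₀
        with facetPiece-facet i F-facet
      ... | F⊆Fᵢ , Fᵢ⊆F
        -- `F` and `facets i` have the same members, so the two distinct vertices of `F` make
        -- `facets i` non-unitary and `large` yields the length bound.
        with assign-onto _≟V_ {d = w₀} (deduplicate-! _≟V_ (facets i))
               (large (facets i) (isFacet i , x , y , F⊆Fᵢ x∈F , F⊆Fᵢ y∈F , x≢y))
               (∈-deduplicate⁺ _≟W_ w∈G₀)
      ... | v , v∈Fᵢ , w≡φv =
        mapWith∈⁺ (λ {v} _ → φ v) (v , Fᵢ⊆F (∈-deduplicate⁻ _≟V_ (facets i) v∈Fᵢ) , w≡φv)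

    facetCover : Fin m → FacetCover L H m
    facetCover i₀ = record
      { piece = facetPiece
      ; union = locate , λ (_ , S∈L , _) → S∈L
      ; map   = facetPiece-map
      }
      where
      locate : ∀ {S} → Simplex L S → ∃[ i ] Simplex (facetPiece i) S
      locate {S} S∈L with any? (λ i → _⊆?_ _≟V_ S (facets i))
      ... | yes (i , S⊆Fᵢ) = i , S∈L , inj₁ S⊆Fᵢ
      -- Uncovered simplices lie in every piece, so any index will do.
      ... | no  uncovered  =
        i₀ , S∈L , inj₂ (S , S∈L , (λ j S⊆Fⱼ → uncovered (j , S⊆Fⱼ)) , ⊆-refl)

Fin⇒1≤ : ∀ {m} → Fin m → 1 ≤ m
Fin⇒1≤ zero    = s≤s z≤n
Fin⇒1≤ (suc _) = s≤s z≤n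

theorem3p18 : {V W : Set} (_≟V_ : DecidableEquality V) (_≟W_ : DecidableEquality W)
    (L : SimplicialComplex V) (H : SimplicialComplex W) →
    ∃ (Facet L) →
    (G₀ : List W) → Facet H G₀ → 2 ≤ size _≟W_ G₀ →
    (∀ G → Facet H G → size _≟W_ G₀ ≤ size _≟W_ G) →
    (c e : ℕ ⁺) → FacetComplexity L H c → FacetNumber L e →
    ((∀ F → NonUnitaryFacet L F → size _≟W_ G₀ ≤ size _≟V_ F) → c ≤⁺ e) ×
    (¬ (∀ F → NonUnitaryFacet L F → size _≟W_ G₀ ≤ size _≟V_ F) → c ≡ ⊤⁺)
theorem3p18 {V} _≟V_ _≟W_ L H (F , F-facet) G₀ G₀-facet 2≤G₀ minimal c e C[L,H]≡c η[L]≡e =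
  (λ large → bound large c e C[L,H]≡c η[L]≡e) , infinite c C[L,H]≡c
  where
  Large : Set
  Large = ∀ F → NonUnitaryFacet L F → size _≟W_ G₀ ≤ size _≟V_ F

  bound : Large → ∀ c e → FacetComplexity L H c → FacetNumber L e → c ≤⁺ e
  bound _     c    ⊤⁺    _ _ = c ≤⊤⁺
  bound large c [ m ] C≡c η≡m = compare c C≡c
    where
    open Bijection η≡m
    facets : Fin m → List V
    facets i = proj₁ (to i)
    complete : ∀ {F} → Facet L F → ∃[ i ] (F ⊆ facets i)
    complete F-facet = let i , hits = surjective (_ , F-facet)
                       in i , λ v∈F → Equivalence.from (hits refl) v∈F
    -- The given facet of `L` must be listed, so `m` is positive: there is a piece to hold the
    -- uncovered simplices, and `m` is an admissible number of pieces.
    i₀ : Fin m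
    i₀ = proj₁ (complete F-facet)
    cover : FacetCover L H m
    cover = facetCover _≟V_ _≟W_ L H G₀-facet 2≤G₀ large facets (λ i → proj₂ (to i)) complete i₀
    compare : ∀ c → FacetComplexity L H c → c ≤⁺ [ m ]
    compare [ k ] (_ , _ , least) = [ least (Fin⇒1≤ i₀) cover ]
    compare ⊤⁺    none            = contradiction cover (none (Fin⇒1≤ i₀))

  infinite : ∀ c → FacetComplexity L H c → ¬ Large → c ≡ ⊤⁺
  infinite ⊤⁺    _               _      = refl
  infinite [ k ] (_ , cover , _) ¬large =
    contradiction (facet-size-bound _≟V_ _≟W_ minimal cover) ¬large
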